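{- Let $V$ be a finite set of propositional variables, $\Sigma=\mathcal P(V)$, and let $N<\omega$ and $M_n',M_n''\subseteq\Sigma^+$, $n=1,\ldots,N$, be regular languages of non-empty finite words. For $\sigma\in\Sigma^\omega$ let $\mathsf{pref}(\sigma)=\{\sigma^0\ldots\sigma^k:k<\omega\}$. (1) If $L\subseteq\Sigma^\omega$ is the reactivity property given by: $\sigma\in L$ iff for some $n\in\{1,\ldots,N\}$ the set $\mathsf{pref}(\sigma)\setminus M_n'$ is finite and $\mathsf{pref}(\sigma)\cap M_n''$ is infinite, then for every $\sigma\in\Sigma^\omega$ and every $\sigma':\mathbb Z\to\Sigma$ extending $\sigma$ (i.e. $\sigma'^k=\sigma^k$ for all $k\ge 0$), $$\sigma\in L\quad\text{iff}\quad \sigma',0,0\models\bigvee_{n=1}^N\Big(\mathit{Fin}(\Sigma^+\setminus M_n')\wedge\neg\mathit{Fin}(M_n'')\Big).$$ (2) If $L\subseteq\Sigma^\omega$ is the reactivity property given by: $\sigma\in L$ iff for all $n\in\{1,\ldots,N\}$ such that $\mathsf{pref}(\sigma)\cap M_n''$ is finite, $\mathsf{pref}(\sigma)\cap M_n'$ is finite too, then for every $\sigma\in\Sigma^\omega$ and every $\sigma':\mathbb Z\to\Sigma$ extending $\sigma$, $$\sigma\in L\quad\text{iff}\quad \sigma',0,0\models\bigwedge_{n=1}^N\Big(\mathit{Fin}(M_n'')\supset\mathit{Fin}(M_n')\Big).$$ Here, for regular $X\subseteq\Sigma^+$, $\mathit{Fin}(X)$ denotes the ITL-NL formula $$\mathit{Fin}(X)=\Diamond_r\bigvee_{k=1}^K(C_{X,k}\wedge\Box_r\neg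 C_{X,k}'),$$ where $C_X$ is a fixed ITL formula defining $X$ and $C_{X,k},C_{X,k}'$, $k=1,\ldots,K$, are fixed ITL formulas such that $C_{X,1},\ldots,C_{X,K}$ is a full system, $\models C_X\equiv\bigvee_{k=1}^K (C_{X,k};C_{X,k}')$ and $\models C_X\equiv\bigwedge_{k=1}^K\neg(C_{X,k};\neg C_{X,k}')$.
   Context: ITL-NL formulas over $V$: $A::=\bot\mid p\mid A\supset A\mid\bigcirc A\mid A;A\mid A^*\mid\Diamond_l A\mid\Diamond_r A$, with $p\in V$. ITL formulas are those without $\Diamond_l,\Diamond_r$. The connectives $\top,\neg,\wedge,\vee,\equiv$ are defined as usual. For $\sigma:\mathbb Z\to\Sigma$ and integers $i\le j$: $\sigma,i,j\not\models\bot$; $\sigma,i,j\models p$ iff $p\in\sigma^i$; $\supset$ is classical implication; $\sigma,i,j\models\bigcirc A$ iff $i<j$ and $\sigma,i+1,j\models A$; $\sigma,i,j\models A;B$ iff $\sigma,i,k\models A$ and $\sigma,k,j\models B$ for some $k\in\{i,\ldots,j\}$; $\sigma,i,j\models A^*$ iff $i=j$ or there are $k_0=i<k_1<\cdots<k_N=j$ with $\sigma,k_{n-1},k_n\models A$ for $n=1,\ldots,N$; $\sigma,i,j\models\Diamond_l A$ iff $\sigma,k,i\models A$ for some $k\le i$; $\sigma,i,j\models\Diamond_r A$ iff $\sigma,j,k\models A$ for some $k\ge j$. $\Box_r A=\neg\Diamond_r\neg A$. $\models A$ (validity) means $\sigma,i,j\models A$ for all $\sigma$ and all $i\le j$. For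 an ITL formula, $\sigma,i,j\models A$ depends only on the finite word $\sigma^i\ldots\sigma^j$, so one can write $\sigma^i\ldots\sigma^j\models A$; an ITL formula $C_X$ defines $X\subseteq\Sigma^+$ if $X=\{u\in\Sigma^+:u\models C_X\}$. It is known that every regular $X\subseteq\Sigma^+$ is defined by an ITL formula and that for every ITL formula $C_X$ formulas $C_{X,k},C_{X,k}'$ as in the claim exist. ITL formulas $A_1,\ldots,A_K$ form a full system if $\models\bigvee_{k}A_k$ and $\models\neg(A_{k_1}\wedge A_{k_2})$ for $k_1\ne k_2$. -}

module Defs where

open import Level using (0ℓ)
open import Data.Empty using (⊥)
open import Data.Fin.Base using (Fin)
open import Data.Fin.Subset as Subset using (Subset)
open import Data.Integer.Base using (ℤ; +_; _+_; _≤_; _<_; 1ℤ)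
open import Data.List.Base using (applyUpTo)
open import Data.List.Membership.Propositional using (_∈_)
open import Data.List.NonEmpty.Base using (List⁺; _∷_; toList)
open import Data.Nat.Base using (ℕ; suc)
open import Data.Product.Base using (∃-syntax; _×_)
open import Data.Sum.Base using (_⊎_)
import Data.Vec.Functional as Vector
open import Function.Base using (_∘_)
open import Relation.Binary.Construct.Closure.Transitive using (TransClosure)
open import Relation.Binary.PropositionalEquality.Core using (_≡_; _≢_)
open import Relation.Binary.PropositionalEquality.Properties using (preorder)
open import Relation.Nullary.Negation.Core using (¬_)
open import Relation.Unary using (Pred; _≐_; _∩_; _∖_)
import Text.Regex.Base as Regex

-- The finite set V of propositional variables is Fin v, so Σ = 𝒫(V) is
-- Subset v.

Word⁺ : ℕ → Set
Word⁺ v = List⁺ (Subset v)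

ωWord : ℕ → Set
ωWord v = ℕ → Subset v

ℤWord : ℕ → Set
ℤWord v = ℤ → Subset v

Language : ℕ → Set₁
Language v = Pred (Word⁺ v) 0ℓ

-- Whether e also matches the empty word is irrelevant: X ⊆ Σ⁺ is regular
-- iff X ∪ {ε} is.
Regular : ∀ {v} → Language v → Set
Regular {v} X = ∃[ e ] X ≐ (λ u → toList u Σ*.∈ e)
  where module Σ* = Regex (preorder (Subset v))

-- prefix σ k = σ⁰ … σᵏ
prefix : ∀ {v} → ωWord v → ℕ → Word⁺ v
prefix σ k = σ 0 ∷ applyUpTo (σ ∘ suc) k

pref : ∀ {v} → ωWord v → Language v
pref σ u = ∃[ k ] u ≡ prefix σ k

-- factor σ i n = σⁱ … σⁱ⁺ⁿ
factor : ∀ {v} → ℤWord v → ℤ → ℕ → Word⁺ v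
factor σ i n = prefix (λ m → σ (i + + m)) n

Finite : ∀ {v} → Language v → Set
Finite {v} X = ∃[ us ] X ≐ (_∈ us)

Infinite : ∀ {v} → Language v → Set
Infinite X = ¬ Finite X

_Extends_ : ∀ {v} → ℤWord v → ωWord v → Set
σ′ Extends σ = ∀ k → σ′ (+ k) ≡ σ k

-- Formulas of ITL-NL

infixr 5 _⊃_
infixr 8 _⨾_
infix  9 ○_ ◇ₗ_ ◇ᵣ_
infix  10 _⋆

data Formula (v : ℕ) : Set where
  ⊥ᶠ      : Formula v
  var     : Fin v → Formula v
  _⊃_ _⨾_ : Formula v → Formula v → Formula v
  ○_ _⋆   : Formula v → Formula v
  ◇ₗ_ ◇ᵣ_ : Formula v → Formula v

data ITL {v : ℕ} : Formula v → Set where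
  ⊥ᶠ  : ITL ⊥ᶠ
  var : ∀ p → ITL (var p)
  _⊃_ : ∀ {A B} → ITL A → ITL B → ITL (A ⊃ B)
  _⨾_ : ∀ {A B} → ITL A → ITL B → ITL (A ⨾ B)
  ○_  : ∀ {A} → ITL A → ITL (○ A)
  _⋆  : ∀ {A} → ITL A → ITL (A ⋆)

infix  9 ¬ᶠ_ □ᵣ_
infixr 7 _∧ᶠ_
infixr 6 _∨ᶠ_
infix  4 _≡ᶠ_

⊤ᶠ : ∀ {v} → Formula v
⊤ᶠ = ⊥ᶠ ⊃ ⊥ᶠ

¬ᶠ_ □ᵣ_ : ∀ {v} → Formula v → Formula v
¬ᶠ A = A ⊃ ⊥ᶠ
□ᵣ A = ¬ᶠ (◇ᵣ (¬ᶠ A))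

_∨ᶠ_ _∧ᶠ_ _≡ᶠ_ : ∀ {v} → Formula v → Formula v → Formula v
A ∨ᶠ B = ¬ᶠ A ⊃ B
A ∧ᶠ B = ¬ᶠ (A ⊃ ¬ᶠ B)
A ≡ᶠ B = (A ⊃ B) ∧ᶠ (B ⊃ A)

⋁ ⋀ : ∀ {v n} → (Fin n → Formula v) → Formula v
⋁ = Vector.foldr _∨ᶠ_ ⊥ᶠ
⋀ = Vector.foldr _∧ᶠ_ ⊤ᶠ

infix 3 _⟨_,_⟩⊨_ _⊨ʷ_ ⊨_

_⟨_,_⟩⊨_ : ∀ {v} → ℤWord v → ℤ → ℤ → Formula v → Set
σ ⟨ i , j ⟩⊨ ⊥ᶠ    = ⊥
σ ⟨ i , j ⟩⊨ var p = p Subset.∈ σ i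
σ ⟨ i , j ⟩⊨ A ⊃ B = (σ ⟨ i , j ⟩⊨ A) → (σ ⟨ i , j ⟩⊨ B)
σ ⟨ i , j ⟩⊨ A ⨾ B = ∃[ k ] i ≤ k × k ≤ j × (σ ⟨ i , k ⟩⊨ A) × (σ ⟨ k , j ⟩⊨ B)
σ ⟨ i , j ⟩⊨ ○ A   = i < j × (σ ⟨ i + 1ℤ , j ⟩⊨ A)
σ ⟨ i , j ⟩⊨ A ⋆   = i ≡ j ⊎ TransClosure (λ k l → k < l × (σ ⟨ k , l ⟩⊨ A)) i j
σ ⟨ i , j ⟩⊨ ◇ₗ A  = ∃[ k ] k ≤ i × (σ ⟨ k , i ⟩⊨ A)
σ ⟨ i , j ⟩⊨ ◇ᵣ A  = ∃[ k ] j ≤ k × (σ ⟨ j , k ⟩⊨ A)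

⊨_ : ∀ {v} → Formula v → Set
⊨ A = ∀ σ i j → i ≤ j → σ ⟨ i , j ⟩⊨ A

-- Truth at a finite word u, meant for ITL formulas only: for these it does
-- not matter at which occurrence σⁱ … σⁱ⁺ⁿ of u the formula is evaluated.
_⊨ʷ_ : ∀ {v} → Word⁺ v → Formula v → Set
u ⊨ʷ A = ∀ σ i n → factor σ i n ≡ u → σ ⟨ i , i + + n ⟩⊨ A

_Defines_ : ∀ {v} → Formula v → Language v → Set
C Defines X = X ≐ (_⊨ʷ C)

record FullSystem {v K : ℕ} (A : Fin K → Formula v) : Set where
  field
    exhaustive : ⊨ ⋁ A
    exclusive  : ∀ k₁ k₂ → k₁ ≢ k₂ → ⊨ ¬ᶠ (A k₁ ∧ᶠ A k₂)

-- The formulas C_X, C_{X,k} and C′_{X,k} fixed for the language X.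
record Representation {v : ℕ} (X : Language v) : Set where
  field
    C         : Formula v
    C-itl     : ITL C
    C-defines : C Defines X
    K         : ℕ
    Cₖ C′ₖ    : Fin K → Formula v
    Cₖ-itl    : ∀ k → ITL (Cₖ k)
    C′ₖ-itl   : ∀ k → ITL (C′ₖ k)
    full      : FullSystem Cₖ
    C≡⋁       : ⊨ C ≡ᶠ ⋁ (λ k → Cₖ k ⨾ C′ₖ k)
    C≡⋀       : ⊨ C ≡ᶠ ⋀ (λ k → ¬ᶠ (Cₖ k ⨾ ¬ᶠ C′ₖ k))

Fin[_] : ∀ {v} {X : Language v} → Representation X → Formula v
Fin[ R ] = ◇ᵣ ⋁ (λ k → Cₖ k ∧ᶠ □ᵣ (¬ᶠ C′ₖ k))
  where open Representation R

Reactivity₁ Reactivity₂ : ∀ {v N} (M′ M″ : Fin N → Language v) → Pred (ωWord v) 0ℓ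
Reactivity₁ M′ M″ σ = ∃[ n ] Finite (pref σ ∖ M′ n) × Infinite (pref σ ∩ M″ n)
Reactivity₂ M′ M″ σ = ∀ n → Finite (pref σ ∩ M″ n) → Finite (pref σ ∩ M′ n)

{-# OPTIONS --safe #-}
-- Since C_{X,1}, …, C_{X,K} is exhaustive, every prefix σ⁰…σᵐ satisfies some
-- C_{X,k}, and then the two decompositions of C_X say that, for all j ≥ m,
-- the prefix σ⁰…σʲ lies in X iff σᵐ…σʲ satisfies C′_{X,k}.  So Fin(X) holds at
-- the origin iff for some m no prefix of length greater than m lies in X, that
-- is, iff pref(σ) ∩ X is finite.
module Submission where

open import Defs
open import Level using (0ℓ)
open import Axiom.ExcludedMiddle using (ExcludedMiddle)
open import Data.Empty using (⊥-elim)
open import Data.Fin.Base using (Fin; zero; suc)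
import Data.Fin.Subset as Subset
open import Data.Integer.Base
  using (ℤ; +_; -_; _+_; _≤_; _<_; 0ℤ; 1ℤ; +≤+)
import Data.Integer.Properties as ℤ
open import Data.List.Base using (_∷_; applyUpTo; filter; map)
open import Data.List.Extrema.Nat using (max; v<max⁺)
open import Data.List.Membership.Propositional using (_∈_)
open import Data.List.Membership.Propositional.Properties
  using (∈-map⁺; ∈-applyUpTo⁺; ∈-applyUpTo⁻; ∈-filter⁺; ∈-filter⁻)
open import Data.List.NonEmpty.Base using (_∷_; toList; length)
open import Data.List.Properties using (∷-injective; length-applyUpTo)
open import Data.List.Relation.Unary.Any as Any using ()
open import Data.Nat.Base as ℕ using (ℕ; zero; suc; z≤n; s≤s; s<s)
import Data.Nat.Properties as ℕ
open import Data.Product.Base as Product using (_×_; _,_; proj₁; proj₂; ∃-syntax)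
open import Data.Sum.Base using (inj₁; inj₂)
open import Function.Base using (_∘_; id)
open import Function.Bundles using (_⇔_; mk⇔)
open import Relation.Binary.Construct.Closure.Transitive
  using (TransClosure; [_]; _∷_)
open import Relation.Binary.PropositionalEquality
  using (_≡_; refl; sym; trans; cong; cong₂; subst; subst₂)
open import Relation.Nullary.Decidable.Core using (yes; no; decidable-stable)
open import Relation.Nullary.Negation.Core using (¬_)
open import Relation.Unary using (∁; _∩_)

private
  variable
    v n : ℕ
    A B : Formula v
    i j : ℤ

-- Prefixes of ω-words and finite sets of them.

applyUpTo-cong : ∀ {a} {S : Set a} {f g : ℕ → S} → (∀ m → f m ≡ g m) →
                 ∀ n → applyUpTo f n ≡ applyUpTo g n
applyUpTo-cong f≗g zero    = refl
applyUpTo-cong f≗g (suc n) = cong₂ _∷_ (f≗g 0) (applyUpTo-cong (f≗g ∘ suc) n)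

applyUpTo-injective : ∀ {a} {S : Set a} {f g : ℕ → S} n k →
                      applyUpTo f n ≡ applyUpTo g k →
                      n ≡ k × (∀ {m} → m ℕ.< n → f m ≡ g m)
applyUpTo-injective zero    zero    _  = refl , λ ()
applyUpTo-injective (suc n) (suc k) eq
  with f0≡g0 , eq′ ← ∷-injective eq
  with n≡k , f≗g ← applyUpTo-injective n k eq′
  = cong suc n≡k , λ { {zero} _ → f0≡g0 ; {suc m} (s<s m<n) → f≗g m<n }

prefix-cong : {ρ σ : ωWord v} → (∀ m → ρ m ≡ σ m) → ∀ k → prefix ρ k ≡ prefix σ k
prefix-cong ρ≗σ k = cong₂ _∷_ (ρ≗σ 0) (applyUpTo-cong (ρ≗σ ∘ suc) k)

prefix-injective : {ρ σ : ωWord v} → ∀ n k → prefix ρ n ≡ prefix σ k →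
                   n ≡ k × (∀ {m} → m ℕ.≤ n → ρ m ≡ σ m)
prefix-injective n k eq
  -- As a list, `prefix ρ n` unfolds to `applyUpTo ρ (suc n)`: index `n` means `suc n` letters.
  with 1+n≡1+k , ρ≗σ ← applyUpTo-injective (suc n) (suc k) (cong toList eq)
  = ℕ.suc-injective 1+n≡1+k , λ m≤n → ρ≗σ (s≤s m≤n)

length-prefix : (σ : ωWord v) → ∀ k → length (prefix σ k) ≡ suc k
length-prefix σ k = cong suc (length-applyUpTo (σ ∘ suc) k)

-- Finiteness of `pref σ ∩ X` in terms of indices. Since `prefix σ j` is determined by `j` and has
-- length `suc j`, a finite set of prefixes is one of bounded index.
EventuallyOutside : Language v → ωWord v → Set
EventuallyOutside X σ = ∃[ m ] (∀ {j} → m ℕ.≤ j → ¬ X (prefix σ j))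

finite⇒eventuallyOutside : {X : Language v} {σ : ωWord v} →
                           Finite (pref σ ∩ X) → EventuallyOutside X σ
finite⇒eventuallyOutside {X = X} {σ} (us , ⊆us , _) = max 0 lengths , outside
  where
  lengths = map length us

  outside : ∀ {j} → max 0 lengths ℕ.≤ j → ¬ X (prefix σ j)
  outside {j} max≤j x = ℕ.<⇒≱ (v<max⁺ 0 lengths (inj₂ j<some)) max≤j
    where
    -- The word in `us` equal to `prefix σ j` has length `suc j`, so its length strictly exceeds
    -- `j`. The base value 0 in `max` only serves an empty list.
    j<some : Any.Any (j ℕ.<_) lengths
    j<some = Any.map
      (λ eq → ℕ.≤-reflexive (trans (sym (length-prefix σ j)) eq))
      (∈-map⁺ length (⊆us ((j , refl) , x)))

-- Translation invariance of ITL formulas.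

Agree : ℤ → ℤWord v → ℤWord v → ℤ → ℤ → Set
Agree c σ τ i j = ∀ k → i ≤ k → k ≤ j → σ k ≡ τ (c + k)

neg-cancelˡ : ∀ c k → - c + (c + k) ≡ k
neg-cancelˡ c k = trans (sym (ℤ.+-assoc (- c) c k))
  (trans (cong (_+ k) (ℤ.+-inverseˡ c)) (ℤ.+-identityˡ k))

neg-cancelʳ : ∀ c k → c + (- c + k) ≡ k
neg-cancelʳ c k = trans (sym (ℤ.+-assoc c (- c) k))
  (trans (cong (_+ k) (ℤ.+-inverseʳ c)) (ℤ.+-identityˡ k))

agree-sym : ∀ c {σ τ : ℤWord v} → Agree c σ τ i j → Agree (- c) τ σ (c + i) (c + j)
agree-sym {i = i} {j = j} c {σ} {τ} agr k c+i≤k k≤c+j = trans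
  (cong τ (sym (neg-cancelʳ c k)))
  (sym (agr (- c + k)
    (subst (_≤ - c + k) (neg-cancelˡ c i) (ℤ.+-monoʳ-≤ (- c) c+i≤k))
    (subst (- c + k ≤_) (neg-cancelˡ c j) (ℤ.+-monoʳ-≤ (- c) k≤c+j))))

agree-narrow : ∀ c {σ} (τ : ℤWord v) {i′ j′} → i ≤ i′ → j′ ≤ j →
               Agree c σ τ i j → Agree c σ τ i′ j′
agree-narrow c τ i≤i′ j′≤j agr k i′≤k k≤j′ =
  agr k (ℤ.≤-trans i≤i′ i′≤k) (ℤ.≤-trans k≤j′ j′≤j)

chain-≤ : ∀ {P : ℤ → ℤ → Set} → TransClosure (λ k l → k < l × P k l) i j → i ≤ j
chain-≤ [ k<l , _ ]       = ℤ.<⇒≤ k<l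
chain-≤ ((k<l , _) ∷ kls) = ℤ.≤-trans (ℤ.<⇒≤ k<l) (chain-≤ kls)

<⇒+1≤ : i < j → i + 1ℤ ≤ j
<⇒+1≤ {i} {j} i<j = subst (_≤ j) (ℤ.+-comm 1ℤ i) (ℤ.i<j⇒suc[i]≤j i<j)

≤-+1 : ∀ i → i ≤ i + 1ℤ
≤-+1 i = ℤ.i≤i+j i 1ℤ

-- Without `◇ₗ` and `◇ᵣ`, evaluation never leaves the interval and refers to positions only relative
-- to its ends. The shift and both words stay general in the induction because implication swaps
-- their roles.
itl-shift : ∀ c {σ τ : ℤWord v} → ITL A → i ≤ j → Agree c σ τ i j →
            σ ⟨ i , j ⟩⊨ A → τ ⟨ c + i , c + j ⟩⊨ A
itl-shift {i = i} c (var p) i≤j agr p∈ =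
  subst (p Subset.∈_) (agr i ℤ.≤-refl i≤j) p∈
-- The antecedent is contravariant: it is carried back from `τ` to `σ` by the shift `- c`, and the
-- endpoints `- c + (c + i)` and `- c + (c + j)` are then simplified.
itl-shift {A = A ⊃ B} {i = i} {j = j} c {σ} (a ⊃ b) i≤j agr f y =
  itl-shift c b i≤j agr (f
    (subst₂ (λ k l → σ ⟨ k , l ⟩⊨ A) (neg-cancelˡ c i) (neg-cancelˡ c j)
      (itl-shift (- c) a (ℤ.+-monoʳ-≤ c i≤j) (agree-sym c agr) y)))
itl-shift c {τ = τ} (a ⨾ b) i≤j agr (k , i≤k , k≤j , x , y) =
  c + k , ℤ.+-monoʳ-≤ c i≤k , ℤ.+-monoʳ-≤ c k≤j ,
  itl-shift c a i≤k (agree-narrow c τ ℤ.≤-refl k≤j agr) x ,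
  itl-shift c b k≤j (agree-narrow c τ i≤k ℤ.≤-refl agr) y
itl-shift {A = ○ A} {i = i} {j = j} c {τ = τ} (○ a) i≤j agr (i<j , x) =
  ℤ.+-monoʳ-< c i<j ,
  subst (λ k → τ ⟨ k , c + j ⟩⊨ A) (sym (ℤ.+-assoc c i 1ℤ))
    (itl-shift c a (<⇒+1≤ i<j) (agree-narrow c τ (≤-+1 i) ℤ.≤-refl agr) x)
itl-shift c (a ⋆) i≤j agr (inj₁ i≡j) = inj₁ (cong (λ k → c + k) i≡j)
itl-shift {A = A ⋆} {j = j} c {σ} {τ} (a ⋆) _ agr (inj₂ kls) = inj₂ (chain agr kls)
  where
  -- Only the left end moves along the chain. The first link needs agreement up to its own end,
  -- which `chain-≤` places before `j`; the tail needs the rest.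
  chain : ∀ {i} → Agree c σ τ i j →
          TransClosure (λ k l → k < l × (σ ⟨ k , l ⟩⊨ A)) i j →
          TransClosure (λ k l → k < l × (τ ⟨ k , l ⟩⊨ A)) (c + i) (c + j)
  chain agr [ k<l , x ] =
    [ ℤ.+-monoʳ-< c k<l , itl-shift c a (ℤ.<⇒≤ k<l) agr x ]
  chain agr ((k<l , x) ∷ kls) =
    (ℤ.+-monoʳ-< c k<l ,
     itl-shift c a (ℤ.<⇒≤ k<l) (agree-narrow c τ ℤ.≤-refl (chain-≤ kls) agr) x)
    ∷ chain (agree-narrow c τ (ℤ.<⇒≤ k<l) ℤ.≤-refl agr) kls

-- `_⊨ʷ_` quantifies over every occurrence of the word, so truth at the single occurrence at the
-- origin of `σ′` has to be translated to all the others.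
⊨⇒prefix⊨ʷ : {σ : ωWord v} {σ′ : ℤWord v} → σ′ Extends σ → ITL A →
             ∀ j → σ′ ⟨ 0ℤ , + j ⟩⊨ A → prefix σ j ⊨ʷ A
⊨⇒prefix⊨ʷ {A = A} {σ} {σ′} ext a j x τ i n eq
  with refl , τ≗σ ← prefix-injective n j eq
  = subst (λ k → τ ⟨ k , i + + j ⟩⊨ A) (ℤ.+-identityʳ i)
      (itl-shift i a (+≤+ z≤n) agree x)
  where
  agree : Agree i σ′ τ 0ℤ (+ j)
  agree (+ k) _ (+≤+ k≤j) = trans (ext k) (sym (τ≗σ k≤j))

-- Classical reading of finiteness and of the derived connectives.

module Classical (em : ExcludedMiddle 0ℓ) where

  stable : {P : Set} → ¬ ¬ P → P
  stable = decidable-stable em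

  eventuallyOutside⇒finite : {X : Language v} {σ : ωWord v} →
                             EventuallyOutside X σ → Finite (pref σ ∩ X)
  eventuallyOutside⇒finite {X = X} {σ} (m , outside) =
    -- Only indices below `m` can contribute; excluded middle decides which of those prefixes lie in
    -- `X`.
    filter X? (applyUpTo (prefix σ) m) , to , from
    where
    X? = λ w → em {X w}

    to : ∀ {w} → (pref σ ∩ X) w → w ∈ filter X? (applyUpTo (prefix σ) m)
    to ((k , refl) , x) =
      ∈-filter⁺ X? (∈-applyUpTo⁺ (prefix σ) (ℕ.≰⇒> λ m≤k → outside m≤k x)) x

    from : ∀ {w} → w ∈ filter X? (applyUpTo (prefix σ) m) → (pref σ ∩ X) w
    from w∈ with w∈′ , x ← ∈-filter⁻ X? {xs = applyUpTo (prefix σ) m} w∈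
            with k , _ , eq ← ∈-applyUpTo⁻ (prefix σ) w∈′
            = (k , eq) , x

  -- Both connectives are encoded by implication and falsity, so their introduction is constructive,
  -- while recovering a pair or an index from them is classical.
  module _ {σ : ℤWord v} {i j : ℤ} where

    ∧ᶠ⁺ : (σ ⟨ i , j ⟩⊨ A) × (σ ⟨ i , j ⟩⊨ B) → σ ⟨ i , j ⟩⊨ A ∧ᶠ B
    ∧ᶠ⁺ (x , y) f = f x y

    ∧ᶠ⁻ : σ ⟨ i , j ⟩⊨ A ∧ᶠ B → (σ ⟨ i , j ⟩⊨ A) × (σ ⟨ i , j ⟩⊨ B)
    ∧ᶠ⁻ xy = stable λ ¬xy → xy λ x y → ¬xy (x , y)

    ⋁⁺ : (A : Fin n → Formula v) → ∃[ k ] (σ ⟨ i , j ⟩⊨ A k) → σ ⟨ i , j ⟩⊨ ⋁ A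
    ⋁⁺ A (zero  , x) ¬x = ⊥-elim (¬x x)
    ⋁⁺ A (suc k , x) _  = ⋁⁺ (A ∘ suc) (k , x)

    ⋁⁻ : (A : Fin n → Formula v) → σ ⟨ i , j ⟩⊨ ⋁ A → ∃[ k ] (σ ⟨ i , j ⟩⊨ A k)
    ⋁⁻ {n = suc n} A f with em {σ ⟨ i , j ⟩⊨ A zero}
    ... | yes x = zero , x
    ... | no ¬x = Product.map suc id (⋁⁻ (A ∘ suc) (f ¬x))

    ⋀⁺ : (A : Fin n → Formula v) → (∀ k → σ ⟨ i , j ⟩⊨ A k) → σ ⟨ i , j ⟩⊨ ⋀ A
    ⋀⁺ {n = zero}  A f = λ ()
    ⋀⁺ {n = suc n} A f = ∧ᶠ⁺ {A = A zero} {B = ⋀ (A ∘ suc)}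
      (f zero , ⋀⁺ (A ∘ suc) (f ∘ suc))

    ⋀⁻ : (A : Fin n → Formula v) → σ ⟨ i , j ⟩⊨ ⋀ A → ∀ k → σ ⟨ i , j ⟩⊨ A k
    ⋀⁻ A x zero    = proj₁ (∧ᶠ⁻ {A = A zero} {B = ⋀ (A ∘ suc)} x)
    ⋀⁻ A x (suc k) = ⋀⁻ (A ∘ suc) (proj₂ (∧ᶠ⁻ {A = A zero} {B = ⋀ (A ∘ suc)} x)) k

  -- `Fin[ R ]` at the origin and finiteness of `pref σ ∩ X`.

  module _ {X : Language v} (R : Representation X)
           (σ : ωWord v) {σ′ : ℤWord v} (ext : σ′ Extends σ) where

    open Representation R
    open FullSystem full

    C⁻ : ∀ {j} → σ′ ⟨ 0ℤ , + j ⟩⊨ C → X (prefix σ j)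
    C⁻ {j} x = proj₂ C-defines (⊨⇒prefix⊨ʷ {σ = σ} ext C-itl j x)

    C⁺ : ∀ {j} → X (prefix σ j) → σ′ ⟨ 0ℤ , + j ⟩⊨ C
    -- The origin is one of the occurrences quantified over; `0ℤ + + m` computes to `+ m`, so `ext`
    -- fits directly.
    C⁺ {j} x = proj₁ C-defines x σ′ 0ℤ j (prefix-cong ext j)

    -- The interval chopped at `m` witnesses disjunct `k` of `C≡⋁`.
    C′⇒∈ : ∀ {m j k} → m ℕ.≤ j → σ′ ⟨ 0ℤ , + m ⟩⊨ Cₖ k →
           σ′ ⟨ + m , + j ⟩⊨ C′ₖ k → X (prefix σ j)
    C′⇒∈ {m} {j} {k} m≤j x y = C⁻ (proj₂ (∧ᶠ⁻ {A = C ⊃ D} {B = D ⊃ C}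
        (C≡⋁ σ′ 0ℤ (+ j) (+≤+ z≤n)))
      (⋁⁺ (λ k → Cₖ k ⨾ C′ₖ k) (k , + m , +≤+ z≤n , +≤+ m≤j , x , y)))
      where D = ⋁ (λ k → Cₖ k ⨾ C′ₖ k)

    -- If `C′ₖ k` failed after `m`, the chop at `m` would contradict conjunct `k` of `C≡⋀`.
    ∈⇒C′ : ∀ {m j k} → m ℕ.≤ j → σ′ ⟨ 0ℤ , + m ⟩⊨ Cₖ k →
           X (prefix σ j) → σ′ ⟨ + m , + j ⟩⊨ C′ₖ k
    ∈⇒C′ {m} {j} {k} m≤j x p = stable λ ¬y →
      ⋀⁻ (λ k → ¬ᶠ (Cₖ k ⨾ ¬ᶠ C′ₖ k))
        (proj₁ (∧ᶠ⁻ {A = C ⊃ D} {B = D ⊃ C} (C≡⋀ σ′ 0ℤ (+ j) (+≤+ z≤n))) (C⁺ p))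
        k (+ m , +≤+ z≤n , +≤+ m≤j , x , ¬y)
      where D = ⋀ (λ k → ¬ᶠ (Cₖ k ⨾ ¬ᶠ C′ₖ k))

    Fin⁺ : Finite (pref σ ∩ X) → σ′ ⟨ 0ℤ , 0ℤ ⟩⊨ Fin[ R ]
    Fin⁺ finite
      with m , outside ← finite⇒eventuallyOutside {σ = σ} finite
      -- The bound `m` serves as the witness of `◇ᵣ`, and exhaustiveness on the interval from 0 to
      -- `m` supplies the disjunct.
      with k , x ← ⋁⁻ Cₖ (exhaustive σ′ 0ℤ (+ m) (+≤+ z≤n))
      = + m , +≤+ z≤n ,
        ⋁⁺ (λ k → Cₖ k ∧ᶠ □ᵣ (¬ᶠ C′ₖ k))
          (k , ∧ᶠ⁺ {A = Cₖ k} {B = □ᵣ (¬ᶠ C′ₖ k)}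
            -- `□ᵣ (¬ᶠ C′ₖ k)` unfolds to the absence of a `j` with `C′ₖ k` doubly negated.
            (x , λ { (+ j , +≤+ m≤j , ¬¬y) →
                     ¬¬y λ y → outside m≤j (C′⇒∈ m≤j x y) }))

    Fin⁻ : σ′ ⟨ 0ℤ , 0ℤ ⟩⊨ Fin[ R ] → Finite (pref σ ∩ X)
    -- Conversely, the `◇ᵣ` witness, a natural number since it is at least 0, is the bound beyond
    -- which no prefix lies in `X`.
    Fin⁻ (+ m , +≤+ z≤n , f)
      with k , g ← ⋁⁻ (λ k → Cₖ k ∧ᶠ □ᵣ (¬ᶠ C′ₖ k)) f
      with x , never ← ∧ᶠ⁻ {A = Cₖ k} {B = □ᵣ (¬ᶠ C′ₖ k)} g
      = eventuallyOutside⇒finite {σ = σ}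
          (m , λ {j} m≤j p → never (+ j , +≤+ m≤j , λ ¬y → ¬y (∈⇒C′ m≤j x p)))

mainTheorem1 : ExcludedMiddle 0ℓ →
    (v N : ℕ) (M′ M″ : Fin N → Language v) →
    (∀ n → Regular (M′ n)) → (∀ n → Regular (M″ n)) →
    ((R′ᶜ : ∀ n → Representation (∁ (M′ n))) (R″ : ∀ n → Representation (M″ n)) →
    (σ : ωWord v) (σ′ : ℤWord v) → σ′ Extends σ →
    Reactivity₁ M′ M″ σ ⇔ (σ′ ⟨ 0ℤ , 0ℤ ⟩⊨ ⋁ (λ n → Fin[ R′ᶜ n ] ∧ᶠ ¬ᶠ Fin[ R″ n ])))
    ×
    ((R′ : ∀ n → Representation (M′ n)) (R″ : ∀ n → Representation (M″ n)) →
    (σ : ωWord v) (σ′ : ℤWord v) → σ′ Extends σ →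
    Reactivity₂ M′ M″ σ ⇔ (σ′ ⟨ 0ℤ , 0ℤ ⟩⊨ ⋀ (λ n → Fin[ R″ n ] ⊃ Fin[ R′ n ])))
mainTheorem1 em v N M′ M″ _ _ =
  -- `pref σ ∖ M′ n` is by definition `pref σ ∩ ∁ (M′ n)`, so `Fin⁺` and `Fin⁻` apply to the
  -- complement as they stand; the infinite half is their contraposition.
  (λ R′ᶜ R″ σ σ′ ext → let D = λ n → Fin[ R′ᶜ n ] ∧ᶠ ¬ᶠ Fin[ R″ n ] in mk⇔
    (λ (n , fin , inf) → ⋁⁺ D
      (n , ∧ᶠ⁺ {i = 0ℤ} {A = Fin[ R′ᶜ n ]} {B = ¬ᶠ Fin[ R″ n ]}
        (Fin⁺ (R′ᶜ n) σ ext fin , inf ∘ Fin⁻ (R″ n) σ ext)))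
    (λ x → let n , y = ⋁⁻ D x
               fin , inf = ∧ᶠ⁻ {i = 0ℤ} {A = Fin[ R′ᶜ n ]} {B = ¬ᶠ Fin[ R″ n ]} y
           in n , Fin⁻ (R′ᶜ n) σ ext fin , inf ∘ Fin⁺ (R″ n) σ ext)) ,
  (λ R′ R″ σ σ′ ext → let D = λ n → Fin[ R″ n ] ⊃ Fin[ R′ n ] in mk⇔
    (λ r → ⋀⁺ D λ n → Fin⁺ (R′ n) σ ext ∘ r n ∘ Fin⁻ (R″ n) σ ext)
    (λ x n → Fin⁻ (R′ n) σ ext ∘ ⋀⁻ D x n ∘ Fin⁺ (R″ n) σ ext))
  where open Classical em
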